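{- There exist absolute constants $K,c>0$ such that for every integer $d\ge1$ there is a finite set $\mathcal S$ of at most $Kd$ real polynomials of degree at most $2$ with $\|f-g\|_\infty\le2$ for all $f,g\in\mathcal S$, such that for every real polynomial $q$ of degree at most $d$ there is some $f\in\mathcal S$ with $$\|q-f\|_\infty\ge 1+\frac{c}{d^3}.$$
   Context: $\|f\|_\infty=\sup_{x\in[-1,1]}|f(x)|$. -}

module Defs where

open import Data.Integer.Base using (+_)
open import Data.Nat.Base as ℕ using (ℕ; suc)
import Data.Nat.Properties as ℕ
open import Data.Product.Base using (∃-syntax; _×_; _,_)
open import Data.Rational.Base as ℚ using (ℚ; 0ℚ; 1ℚ; ½)
import Data.Rational.Properties as ℚ
open import Data.Rational.Solver using (module +-*-Solver)
open import Data.Sum.Base using (inj₁; inj₂)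
open import Data.Vec.Base using (Vec; foldr′)
open import Relation.Binary.PropositionalEquality
  using (_≡_; refl; sym; trans; cong; cong₂; subst; subst₂)

open +-*-Solver using (solve; con; _:=_; _:+_; _:*_; _:-_; :-_)

infix  4 _≤_ _<_ ‖_‖∞≤_ ‖_‖∞≥_
infix  8 -_
infixl 7 _*_ _÷_
infixl 6 _+_ _-_

0<½*ε : ∀ {ε} → 0ℚ ℚ.< ε → 0ℚ ℚ.< ½ ℚ.* ε
0<½*ε {ε} 0<ε =
  ℚ.positive⁻¹ (½ ℚ.* ε) {{ℚ.pos*pos⇒pos ½ ε {{ℚ.positive 0<ε}}}}

½*ε+½*ε≡ε : ∀ ε → ½ ℚ.* ε ℚ.+ ½ ℚ.* ε ≡ ε
½*ε+½*ε≡ε = solve 1 (λ ε → con ½ :* ε :+ con ½ :* ε := ε) refl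

q-p≡-p--q : ∀ p q → q ℚ.- p ≡ (ℚ.- p) ℚ.- (ℚ.- q)
q-p≡-p--q = solve 2 (λ p q → q :- p := :- p :- :- q) refl

q+p-q≡p : ∀ p q → q ℚ.+ (p ℚ.- q) ≡ p
q+p-q≡p = solve 2 (λ p q → q :+ (p :- q) := p) refl

q+r-q≡r : ∀ q r → q ℚ.+ r ℚ.- q ≡ r
q+r-q≡r = solve 2 (λ q r → q :+ r :- q := r) refl

p-q≡-[q-p] : ∀ p q → p ℚ.- q ≡ ℚ.- (q ℚ.- p)
p-q≡-[q-p] = solve 2 (λ p q → p :- q := :- (q :- p)) refl

+-diff : ∀ a b c d → (a ℚ.+ b) ℚ.- (c ℚ.+ d) ≡ (a ℚ.- c) ℚ.+ (b ℚ.- d)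
+-diff = solve 4 (λ a b c d → (a :+ b) :- (c :+ d) := (a :- c) :+ (b :- d)) refl

*-diff : ∀ a b c d → a ℚ.* b ℚ.- c ℚ.* d ≡ a ℚ.* (b ℚ.- d) ℚ.+ d ℚ.* (a ℚ.- c)
*-diff = solve 4 (λ a b c d → a :* b :- c :* d := a :* (b :- d) :+ d :* (a :- c)) refl

∣p∣≤∣q∣+∣p-q∣ : ∀ p q → ℚ.∣ p ∣ ℚ.≤ ℚ.∣ q ∣ ℚ.+ ℚ.∣ p ℚ.- q ∣
∣p∣≤∣q∣+∣p-q∣ p q =
  subst (λ r → ℚ.∣ r ∣ ℚ.≤ ℚ.∣ q ∣ ℚ.+ ℚ.∣ p ℚ.- q ∣)
    (q+p-q≡p p q)
    (ℚ.∣p+q∣≤∣p∣+∣q∣ q (p ℚ.- q))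

∣p-q∣≡∣q-p∣ : ∀ p q → ℚ.∣ p ℚ.- q ∣ ≡ ℚ.∣ q ℚ.- p ∣
∣p-q∣≡∣q-p∣ p q =
  trans (cong ℚ.∣_∣ (p-q≡-[q-p] p q))
        (ℚ.∣-p∣≡∣p∣ (q ℚ.- p))

∣∣p∣-∣q∣∣≤∣p-q∣ : ∀ p q → ℚ.∣ ℚ.∣ p ∣ ℚ.- ℚ.∣ q ∣ ∣ ℚ.≤ ℚ.∣ p ℚ.- q ∣
∣∣p∣-∣q∣∣≤∣p-q∣ p q with ℚ.∣p∣≡p∨∣p∣≡-p (ℚ.∣ p ∣ ℚ.- ℚ.∣ q ∣)
... | inj₁ eq = subst (ℚ._≤ ℚ.∣ p ℚ.- q ∣) (sym eq) (half p q)
  where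
  half : ∀ p q → ℚ.∣ p ∣ ℚ.- ℚ.∣ q ∣ ℚ.≤ ℚ.∣ p ℚ.- q ∣
  half p q =
    subst (ℚ.∣ p ∣ ℚ.- ℚ.∣ q ∣ ℚ.≤_)
      (q+r-q≡r ℚ.∣ q ∣ ℚ.∣ p ℚ.- q ∣)
      (ℚ.+-monoˡ-≤ (ℚ.- ℚ.∣ q ∣) (∣p∣≤∣q∣+∣p-q∣ p q))
... | inj₂ eq =
  subst₂ ℚ._≤_
    (trans (p-q≡-[q-p] ℚ.∣ q ∣ ℚ.∣ p ∣) (sym eq))
    (trans
      (q+r-q≡r ℚ.∣ p ∣ ℚ.∣ q ℚ.- p ∣)
      (∣p-q∣≡∣q-p∣ q p))
    (ℚ.+-monoˡ-≤ (ℚ.- ℚ.∣ p ∣) (∣p∣≤∣q∣+∣p-q∣ q p))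

∣p*q∣≤ : ∀ {p q a b} → ℚ.∣ p ∣ ℚ.≤ a → ℚ.∣ q ∣ ℚ.≤ b → ℚ.∣ p ℚ.* q ∣ ℚ.≤ a ℚ.* b
∣p*q∣≤ {p} {q} {a} {b} p≤a q≤b = begin
  ℚ.∣ p ℚ.* q ∣        ≡⟨ ℚ.∣p*q∣≡∣p∣*∣q∣ p q ⟩
  ℚ.∣ p ∣ ℚ.* ℚ.∣ q ∣  ≤⟨ ℚ.*-monoʳ-≤-nonNeg ℚ.∣ q ∣ {{ℚ.nonNegative (ℚ.0≤∣p∣ q)}} p≤a ⟩
  a ℚ.* ℚ.∣ q ∣        ≤⟨ ℚ.*-monoˡ-≤-nonNeg a {{ℚ.nonNegative (ℚ.≤-trans (ℚ.0≤∣p∣ p) p≤a)}} q≤b ⟩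
  a ℚ.* b              ∎
  where open ℚ.≤-Reasoning

shrink : ∀ {b ε} → 0ℚ ℚ.< b → 0ℚ ℚ.< ε → ∃[ δ ] 0ℚ ℚ.< δ × b ℚ.* δ ≡ ε
shrink {b} {ε} 0<b 0<ε = b⁻¹ ℚ.* ε , ℚ.positive⁻¹ _ {{pos}} , eq
  where
  instance
    b-pos : ℚ.Positive b
    b-pos = ℚ.positive 0<b
    b≢0 : ℚ.NonZero b
    b≢0 = ℚ.pos⇒nonZero b
  b⁻¹ : ℚ
  b⁻¹ = ℚ.1/ b
  pos : ℚ.Positive (b⁻¹ ℚ.* ε)
  pos = ℚ.pos*pos⇒pos b⁻¹ {{ℚ.1/pos⇒pos b}} ε {{ℚ.positive 0<ε}}
  eq : b ℚ.* (b⁻¹ ℚ.* ε) ≡ ε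
  eq = trans (sym (ℚ.*-assoc b b⁻¹ ε))
         (trans (cong (ℚ._* ε) (ℚ.*-inverseʳ b)) (ℚ.*-identityˡ ε))

-- A real number is a Cauchy sequence of rationals.  Distinct sequences can
-- represent the same real; equality of x and y is x ≤ y × y ≤ x.

IsCauchy : (ℕ → ℚ) → Set
IsCauchy x = ∀ ε → 0ℚ ℚ.< ε →
  ∃[ N ] ∀ m n → N ℕ.≤ m → N ℕ.≤ n → ℚ.∣ x m ℚ.- x n ∣ ℚ.≤ ε

record ℝ : Set where
  constructor mkℝ
  field
    seq    : ℕ → ℚ
    cauchy : IsCauchy seq

open ℝ public

_≤_ : ℝ → ℝ → Set
x ≤ y = ∀ ε → 0ℚ ℚ.< ε → ∃[ N ] ∀ n → N ℕ.≤ n → seq x n ℚ.≤ seq y n ℚ.+ ε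

_<_ : ℝ → ℝ → Set
x < y = ∃[ ε ] 0ℚ ℚ.< ε × (∃[ N ] ∀ n → N ℕ.≤ n → seq x n ℚ.+ ε ℚ.≤ seq y n)

fromℚ : ℚ → ℝ
fromℚ p = mkℝ (λ _ → p) λ ε 0<ε → 0 , λ _ _ _ _ →
  subst (λ r → ℚ.∣ r ∣ ℚ.≤ ε) (sym (ℚ.+-inverseʳ p)) (ℚ.<⇒≤ 0<ε)

fromℕ : ℕ → ℝ
fromℕ n = fromℚ (+ n ℚ./ 1)

0ℝ 1ℝ 2ℝ : ℝ
0ℝ = fromℕ 0
1ℝ = fromℕ 1
2ℝ = fromℕ 2

+-cauchy : ∀ x y → IsCauchy x → IsCauchy y → IsCauchy (λ n → x n ℚ.+ y n)
+-cauchy x y cx cy ε 0<ε =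
  let M , hx = cx (½ ℚ.* ε) (0<½*ε 0<ε)
      N , hy = cy (½ ℚ.* ε) (0<½*ε 0<ε)
  in M ℕ.⊔ N , λ m n p q → begin
    ℚ.∣ (x m ℚ.+ y m) ℚ.- (x n ℚ.+ y n) ∣
      ≡⟨ cong ℚ.∣_∣ (+-diff (x m) (y m) (x n) (y n)) ⟩
    ℚ.∣ (x m ℚ.- x n) ℚ.+ (y m ℚ.- y n) ∣
      ≤⟨ ℚ.∣p+q∣≤∣p∣+∣q∣ (x m ℚ.- x n) (y m ℚ.- y n) ⟩
    ℚ.∣ x m ℚ.- x n ∣ ℚ.+ ℚ.∣ y m ℚ.- y n ∣
      ≤⟨ ℚ.+-mono-≤ (hx m n (ℕ.m⊔n≤o⇒m≤o M N p) (ℕ.m⊔n≤o⇒m≤o M N q))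
                    (hy m n (ℕ.m⊔n≤o⇒n≤o M N p) (ℕ.m⊔n≤o⇒n≤o M N q)) ⟩
    ½ ℚ.* ε ℚ.+ ½ ℚ.* ε
      ≡⟨ ½*ε+½*ε≡ε ε ⟩
    ε ∎
  where open ℚ.≤-Reasoning

neg-cauchy : ∀ x → IsCauchy x → IsCauchy (λ n → ℚ.- x n)
neg-cauchy x cx ε 0<ε =
  let N , h = cx ε 0<ε
  in N , λ m n p q →
    subst (λ r → ℚ.∣ r ∣ ℚ.≤ ε)
      (q-p≡-p--q (x m) (x n))
      (h n m q p)

∣∣-cauchy : ∀ x → IsCauchy x → IsCauchy (λ n → ℚ.∣ x n ∣)
∣∣-cauchy x cx ε 0<ε =
  let N , h = cx ε 0<ε
  in N , λ m n p q → ℚ.≤-trans (∣∣p∣-∣q∣∣≤∣p-q∣ (x m) (x n)) (h m n p q)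

bounded : ∀ x → IsCauchy x →
          ∃[ b ] 0ℚ ℚ.< b × (∃[ N ] ∀ n → N ℕ.≤ n → ℚ.∣ x n ∣ ℚ.≤ b)
bounded x cx =
  let N , h = cx 1ℚ (ℚ.positive⁻¹ 1ℚ)
  in ℚ.∣ x N ∣ ℚ.+ 1ℚ
  , ℚ.+-mono-≤-< (ℚ.0≤∣p∣ (x N)) (ℚ.positive⁻¹ 1ℚ)
  , N
  , λ n N≤n → ℚ.≤-trans (∣p∣≤∣q∣+∣p-q∣ (x n) (x N))
                (ℚ.+-monoʳ-≤ ℚ.∣ x N ∣ (h n N N≤n ℕ.≤-refl))

*-cauchy : ∀ x y → IsCauchy x → IsCauchy y → IsCauchy (λ n → x n ℚ.* y n)
*-cauchy x y cx cy ε 0<ε =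
  let a , 0<a , A , x≤a = bounded x cx
      b , 0<b , B , y≤b = bounded y cy
      δ , 0<δ , aδ = shrink 0<a (0<½*ε 0<ε)
      γ , 0<γ , bγ = shrink 0<b (0<½*ε 0<ε)
      M , hx = cx γ 0<γ
      N , hy = cy δ 0<δ
  in (A ℕ.⊔ B) ℕ.⊔ (M ℕ.⊔ N) , λ m n p q →
    let A⊔B≤m = ℕ.m⊔n≤o⇒m≤o (A ℕ.⊔ B) (M ℕ.⊔ N) p
        A⊔B≤n = ℕ.m⊔n≤o⇒m≤o (A ℕ.⊔ B) (M ℕ.⊔ N) q
        M⊔N≤m = ℕ.m⊔n≤o⇒n≤o (A ℕ.⊔ B) (M ℕ.⊔ N) p
        M⊔N≤n = ℕ.m⊔n≤o⇒n≤o (A ℕ.⊔ B) (M ℕ.⊔ N) q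
    in begin
    ℚ.∣ x m ℚ.* y m ℚ.- x n ℚ.* y n ∣
      ≡⟨ cong ℚ.∣_∣ (*-diff (x m) (y m) (x n) (y n)) ⟩
    ℚ.∣ x m ℚ.* (y m ℚ.- y n) ℚ.+ y n ℚ.* (x m ℚ.- x n) ∣
      ≤⟨ ℚ.∣p+q∣≤∣p∣+∣q∣ (x m ℚ.* (y m ℚ.- y n)) (y n ℚ.* (x m ℚ.- x n)) ⟩
    ℚ.∣ x m ℚ.* (y m ℚ.- y n) ∣ ℚ.+ ℚ.∣ y n ℚ.* (x m ℚ.- x n) ∣
      ≤⟨ ℚ.+-mono-≤
           (∣p*q∣≤ {x m} {y m ℚ.- y n} (x≤a m (ℕ.m⊔n≤o⇒m≤o A B A⊔B≤m))
              (hy m n (ℕ.m⊔n≤o⇒n≤o M N M⊔N≤m) (ℕ.m⊔n≤o⇒n≤o M N M⊔N≤n)))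
           (∣p*q∣≤ {y n} {x m ℚ.- x n} (y≤b n (ℕ.m⊔n≤o⇒n≤o A B A⊔B≤n))
              (hx m n (ℕ.m⊔n≤o⇒m≤o M N M⊔N≤m) (ℕ.m⊔n≤o⇒m≤o M N M⊔N≤n))) ⟩
    a ℚ.* δ ℚ.+ b ℚ.* γ
      ≡⟨ cong₂ ℚ._+_ aδ bγ ⟩
    ½ ℚ.* ε ℚ.+ ½ ℚ.* ε
      ≡⟨ ½*ε+½*ε≡ε ε ⟩
    ε ∎
  where open ℚ.≤-Reasoning

_+_ : ℝ → ℝ → ℝ
x + y = mkℝ (λ n → seq x n ℚ.+ seq y n) (+-cauchy (seq x) (seq y) (cauchy x) (cauchy y))

-_ : ℝ → ℝ
- x = mkℝ (λ n → ℚ.- seq x n) (neg-cauchy (seq x) (cauchy x))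

_-_ : ℝ → ℝ → ℝ
x - y = x + - y

_*_ : ℝ → ℝ → ℝ
x * y = mkℝ (λ n → seq x n ℚ.* seq y n) (*-cauchy (seq x) (seq y) (cauchy x) (cauchy y))

_÷_ : ℝ → (n : ℕ) → .{{ℕ.NonZero n}} → ℝ
x ÷ n = x * fromℚ (+ 1 ℚ./ n)

∣_∣ : ℝ → ℝ
∣ x ∣ = mkℝ (λ n → ℚ.∣ seq x n ∣) (∣∣-cauchy (seq x) (cauchy x))

-- Real polynomials of degree at most n: a₀ ∷ a₁ ∷ … ∷ aₙ ∷ [] stands for
-- a₀ + a₁ X + … + aₙ Xⁿ, with no condition on aₙ.

Poly≤ : ℕ → Set
Poly≤ n = Vec ℝ (suc n)

⟦_⟧ : ∀ {n} → Poly≤ n → ℝ → ℝ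
⟦ p ⟧ x = foldr′ (λ a r → a + x * r) 0ℝ p

-- s is the least upper bound of ∣ f x ∣ over x ∈ [-1 , 1].

BoundedBy : (ℝ → ℝ) → ℝ → Set
BoundedBy f b = ∀ x → - 1ℝ ≤ x → x ≤ 1ℝ → ∣ f x ∣ ≤ b

IsSupNorm : (ℝ → ℝ) → ℝ → Set
IsSupNorm f s = BoundedBy f s × (∀ b → BoundedBy f b → s ≤ b)

-- The supremum is asserted to exist, so neither inequality holds vacuously.

‖_‖∞≤_ : (ℝ → ℝ) → ℝ → Set
‖ f ‖∞≤ t = ∃[ s ] IsSupNorm f s × s ≤ t

‖_‖∞≥_ : (ℝ → ℝ) → ℝ → Set
‖ f ‖∞≥ t = ∃[ s ] IsSupNorm f s × t ≤ s

{-# OPTIONS --safe #-}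
module Submission where

-- Put h = 1/(d+1), x_j = j h and η = h²/8, and let
--   f_j = (-1)^j (1 + η - (x - x_j)²/2),   j = 0, …, d + 1.
-- If j and k differ in parity, then |f_j - f_k| ≤ 2 because
-- (x - x_j)² + (x - x_k)² ≥ h²/2.  A polynomial q of degree at most d
-- is annihilated by the (d+1)-st difference with step h, so the values
-- (-1)^j q(x_j) cannot all be positive; where one is nonpositive, q is at distance
-- at least 1 + η from f_j, and η ≥ 1/(32 d³).
-- Half of η pays for choosing j constructively, from a rational approximation of q.

open import Defs
open import Data.Integer.Base as ℤ using (+_)
import Data.Integer.Properties as ℤ
open import Data.List.Base using (List; length; applyUpTo)
open import Data.List.Membership.Propositional using (_∈_)
open import Data.List.Membership.Propositional.Properties using (∈-applyUpTo⁺; ∈-applyUpTo⁻)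
open import Data.List.Properties using (length-applyUpTo)
open import Data.Nat.Base as ℕ using (ℕ; NonZero; _^_; zero; suc; z≤n; s≤s)
import Data.Nat.Properties as ℕ
open import Data.Nat.Properties using (m^n≢0)
import Data.Nat.Solver as ℕ
open import Data.Product.Base using (Σ-syntax; ∃-syntax; _×_; _,_; proj₁; proj₂)
open import Data.Rational.Base as ℚ using (ℚ; 0ℚ; 1ℚ; ½)
import Data.Rational.Properties as ℚ
import Data.Rational.Unnormalised.Base as ℚᵘ
import Data.Rational.Unnormalised.Properties as ℚᵘ
open import Data.Rational.Solver using (module +-*-Solver)
open import Data.Sum.Base using (_⊎_; inj₁; inj₂)
open import Data.Vec.Base using (Vec; []; _∷_; foldr′)
open import Relation.Binary.Definitions using (tri<; tri≈; tri>)
open import Relation.Binary.PropositionalEquality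
  using (_≡_; _≢_; refl; sym; trans; cong; cong₂; subst; subst₂)
open import Relation.Nullary using (yes; no; contradiction)

module ℕ-Solver = ℕ.+-*-Solver
open +-*-Solver using (solve; con; _:=_; _:+_; _:*_; _:-_; :-_)

-- Inequalities between rationals

2ℚ ⅛ : ℚ
2ℚ = + 2 ℚ./ 1
⅛ = + 1 ℚ./ 8

p≤q⇒0≤q-p : ∀ {p q} → p ℚ.≤ q → 0ℚ ℚ.≤ q ℚ.- p
p≤q⇒0≤q-p {p} {q} p≤q = subst (ℚ._≤ q ℚ.- p) (ℚ.+-inverseʳ p) (ℚ.+-monoˡ-≤ (ℚ.- p) p≤q)

-- The pattern of most estimates below: the difference of the two sides is rewritten by the ring
-- solver as an expression `r` built from visibly nonnegative pieces.
≤-by : ∀ {p q r} → 0ℚ ℚ.≤ r → q ℚ.- p ≡ r → p ℚ.≤ q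
≤-by {p} {q} {r} 0≤r eq = subst₂ ℚ._≤_ (ℚ.+-identityˡ p)
  (trans (cong (ℚ._+ p) (sym eq)) (solve 2 (λ p q → q :- p :+ p := q) refl p q))
  (ℚ.+-monoˡ-≤ p 0≤r)

0≤p+q : ∀ {p q} → 0ℚ ℚ.≤ p → 0ℚ ℚ.≤ q → 0ℚ ℚ.≤ p ℚ.+ q
0≤p+q = ℚ.+-mono-≤

0≤p*q : ∀ {p q} → 0ℚ ℚ.≤ p → 0ℚ ℚ.≤ q → 0ℚ ℚ.≤ p ℚ.* q
0≤p*q {p} {q} 0≤p 0≤q = ℚ.nonNegative⁻¹ (p ℚ.* q)
  {{ℚ.nonNeg*nonNeg⇒nonNeg p {{ℚ.nonNegative 0≤p}} q {{ℚ.nonNegative 0≤q}}}}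

p≤∣p∣ : ∀ p → p ℚ.≤ ℚ.∣ p ∣
p≤∣p∣ p with ℚ.≤-total 0ℚ p
... | inj₁ 0≤p = ℚ.≤-reflexive (sym (ℚ.0≤p⇒∣p∣≡p 0≤p))
... | inj₂ p≤0 = ℚ.≤-trans p≤0 (ℚ.0≤∣p∣ p)

-p≤∣p∣ : ∀ p → ℚ.- p ℚ.≤ ℚ.∣ p ∣
-p≤∣p∣ p = subst (ℚ.- p ℚ.≤_) (ℚ.∣-p∣≡∣p∣ p) (p≤∣p∣ (ℚ.- p))

∣p∣≤ : ∀ {p b} → p ℚ.≤ b → ℚ.- p ℚ.≤ b → ℚ.∣ p ∣ ℚ.≤ b
∣p∣≤ {p} {b} p≤b -p≤b with ℚ.∣p∣≡p∨∣p∣≡-p p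
... | inj₁ eq = subst (ℚ._≤ b) (sym eq) p≤b
... | inj₂ eq = subst (ℚ._≤ b) (sym eq) -p≤b

0≤p*p : ∀ p → 0ℚ ℚ.≤ p ℚ.* p
0≤p*p p with ℚ.≤-total 0ℚ p
... | inj₁ 0≤p = 0≤p*q 0≤p 0≤p
... | inj₂ p≤0 = subst (0ℚ ℚ.≤_) (solve 1 (λ p → (:- p) :* (:- p) := p :* p) refl p)
  (0≤p*q (ℚ.neg-antimono-≤ p≤0) (ℚ.neg-antimono-≤ p≤0))

0<½ : 0ℚ ℚ.< ½
0<½ = ℚ.positive⁻¹ ½

0≤½ : 0ℚ ℚ.≤ ½
0≤½ = ℚ.<⇒≤ 0<½

0≤⅛ : 0ℚ ℚ.≤ ⅛
0≤⅛ = ℚ.nonNegative⁻¹ ⅛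

-- Naturals and their reciprocals in ℚ, by way of unnormalised fractions

fromℚᵘ-homo-+ : ∀ p q → ℚ.fromℚᵘ p ℚ.+ ℚ.fromℚᵘ q ≡ ℚ.fromℚᵘ (p ℚᵘ.+ q)
fromℚᵘ-homo-+ p q = ℚ.toℚᵘ-injective (ℚᵘ.≃-trans
  (ℚ.toℚᵘ-homo-+ (ℚ.fromℚᵘ p) (ℚ.fromℚᵘ q)) (ℚᵘ.≃-trans
  (ℚᵘ.+-cong (ℚ.toℚᵘ-fromℚᵘ p) (ℚ.toℚᵘ-fromℚᵘ q))
  (ℚᵘ.≃-sym (ℚ.toℚᵘ-fromℚᵘ (p ℚᵘ.+ q)))))

fromℚᵘ-homo-* : ∀ p q → ℚ.fromℚᵘ p ℚ.* ℚ.fromℚᵘ q ≡ ℚ.fromℚᵘ (p ℚᵘ.* q)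
fromℚᵘ-homo-* p q = ℚ.toℚᵘ-injective (ℚᵘ.≃-trans
  (ℚ.toℚᵘ-homo-* (ℚ.fromℚᵘ p) (ℚ.fromℚᵘ q)) (ℚᵘ.≃-trans
  (ℚᵘ.*-cong (ℚ.toℚᵘ-fromℚᵘ p) (ℚ.toℚᵘ-fromℚᵘ q))
  (ℚᵘ.≃-sym (ℚ.toℚᵘ-fromℚᵘ (p ℚᵘ.* q)))))

fromℚᵘ-mono-≤ : ∀ {p q} → p ℚᵘ.≤ q → ℚ.fromℚᵘ p ℚ.≤ ℚ.fromℚᵘ q
fromℚᵘ-mono-≤ {p} {q} p≤q = ℚ.toℚᵘ-cancel-≤
  (ℚᵘ.≤-respˡ-≃ (ℚᵘ.≃-sym (ℚ.toℚᵘ-fromℚᵘ p))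
  (ℚᵘ.≤-respʳ-≃ (ℚᵘ.≃-sym (ℚ.toℚᵘ-fromℚᵘ q)) p≤q))

ι : ℕ → ℚ
ι n = + n ℚ./ 1

ι-+ : ∀ m n → ι m ℚ.+ ι n ≡ ι (m ℕ.+ n)
ι-+ m n = trans (fromℚᵘ-homo-+ (ℚᵘ.mkℚᵘ (+ m) 0) (ℚᵘ.mkℚᵘ (+ n) 0))
  (cong (λ i → i ℚ./ 1) (cong₂ ℤ._+_ (ℤ.*-identityʳ (+ m)) (ℤ.*-identityʳ (+ n))))

ι-* : ∀ m n → ι m ℚ.* ι n ≡ ι (m ℕ.* n)
ι-* m n = trans (fromℚᵘ-homo-* (ℚᵘ.mkℚᵘ (+ m) 0) (ℚᵘ.mkℚᵘ (+ n) 0))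
  (cong (λ i → i ℚ./ 1) (sym (ℤ.pos-* m n)))

ι-mono-≤ : ∀ {m n} → m ℕ.≤ n → ι m ℚ.≤ ι n
ι-mono-≤ {m} {n} m≤n = fromℚᵘ-mono-≤ {ℚᵘ.mkℚᵘ (+ m) 0} {ℚᵘ.mkℚᵘ (+ n) 0} (ℚᵘ.*≤* (ℤ.*-monoʳ-≤-nonNeg (+ 1) (ℤ.+≤+ m≤n)))

1/n : (n : ℕ) → .{{NonZero n}} → ℚ
1/n n = + 1 ℚ./ n

ι-inverse : ∀ n .{{_ : NonZero n}} → ι n ℚ.* 1/n n ≡ 1ℚ
ι-inverse (suc n) = trans
  (fromℚᵘ-homo-* (ℚᵘ.mkℚᵘ (+ suc n) 0) (ℚᵘ.mkℚᵘ (+ 1) n))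
  (ℚ.fromℚᵘ-cong {ℚᵘ.mkℚᵘ (+ suc n) 0 ℚᵘ.* ℚᵘ.mkℚᵘ (+ 1) n} {ℚᵘ.1ℚᵘ} (ℚᵘ.*-inverseʳ (ℚᵘ.mkℚᵘ (+ suc n) 0)))

0<1/n : ∀ n .{{_ : NonZero n}} → 0ℚ ℚ.< 1/n n
0<1/n n = ℚ.positive⁻¹ (1/n n) {{ℚ.normalize-pos 1 n}}

0≤1/n : ∀ n .{{_ : NonZero n}} → 0ℚ ℚ.≤ 1/n n
0≤1/n n = ℚ.<⇒≤ (0<1/n n)

archimedean : ∀ {δ} → 0ℚ ℚ.< δ → ∃[ N ] ∀ n → N ℕ.≤ n → 1/n (suc n) ℚ.≤ δ
archimedean {δ} 0<δ = go δ {{ℚ.positive 0<δ}}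
  where
  go : ∀ δ → {{ℚ.Positive δ}} → ∃[ N ] ∀ n → N ℕ.≤ n → 1/n (suc n) ℚ.≤ δ
  -- The numerator is at least 1 and the denominator is `suc q`, so δ is at least 1/(q+1).
  go δ@(ℚ.mkℚ (+ suc p) q _) = q , λ n q≤n → ℚ.toℚᵘ-cancel-≤
    (ℚᵘ.≤-respˡ-≃ (ℚᵘ.≃-sym (ℚ.toℚᵘ-fromℚᵘ (ℚᵘ.mkℚᵘ (+ 1) n)))
      (ℚᵘ.*≤* (subst₂ ℤ._≤_ (sym (ℤ.*-identityˡ (+ suc q))) (ℤ.pos-* (suc p) (suc n))
        (ℤ.+≤+ (ℕ.≤-trans (s≤s q≤n) (ℕ.m≤m+n (suc n) (p ℕ.* suc n)))))))

-- The equispaced points 0, h, 2h, …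

node : ℚ → ℕ → ℚ
node h zero    = 0ℚ
node h (suc j) = node h j ℚ.+ h

node-+ : ∀ h i j → node h (i ℕ.+ j) ≡ node h j ℚ.+ node h i
node-+ h zero    j = sym (ℚ.+-identityʳ (node h j))
node-+ h (suc i) j = trans (cong (ℚ._+ h) (node-+ h i j)) (ℚ.+-assoc (node h j) (node h i) h)

node≡ι* : ∀ h j → node h j ≡ ι j ℚ.* h
node≡ι* h zero    = sym (ℚ.*-zeroˡ h)
node≡ι* h (suc j) = trans (cong (ℚ._+ h) (node≡ι* h j))
  (trans (solve 2 (λ i h → i :* h :+ h := (con 1ℚ :+ i) :* h) refl (ι j) h)
         (cong (ℚ._* h) (ι-+ 1 j)))

node-1/n : ∀ n .{{_ : NonZero n}} → node (1/n n) n ≡ 1ℚ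
node-1/n n = trans (node≡ι* (1/n n) n) (ι-inverse n)

node-mono-≤ : ∀ {h i j} → 0ℚ ℚ.≤ h → i ℕ.≤ j → node h i ℚ.≤ node h j
node-mono-≤ {h} {i} {zero}  0≤h z≤n = ℚ.≤-refl
node-mono-≤ {h} {i} {suc j} 0≤h i≤sj with ℕ.m≤n⇒m<n∨m≡n i≤sj
... | inj₂ refl    = ℚ.≤-refl
... | inj₁ (s≤s i≤j) = ℚ.≤-trans (node-mono-≤ 0≤h i≤j)
  (≤-by 0≤h (q+r-q≡r (node h j) h))

-- Finite maxima and nearest nodes

maxUpTo : (ℕ → ℚ) → ℕ → ℚ
maxUpTo u zero    = u zero
maxUpTo u (suc k) = maxUpTo u k ℚ.⊔ u (suc k)

≤maxUpTo : ∀ u {k j} → j ℕ.≤ k → u j ℚ.≤ maxUpTo u k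
≤maxUpTo u {zero}  z≤n = ℚ.≤-refl
≤maxUpTo u {suc k} j≤sk with ℕ.m≤n⇒m<n∨m≡n j≤sk
... | inj₁ (s≤s j≤k) = ℚ.≤-trans (≤maxUpTo u j≤k) (ℚ.p≤p⊔q _ _)
... | inj₂ refl      = ℚ.p≤q⊔p (maxUpTo u k) _

maxUpTo-attained : ∀ u k → ∃[ j ] j ℕ.≤ k × maxUpTo u k ≡ u j
maxUpTo-attained u zero = zero , z≤n , refl
maxUpTo-attained u (suc k) with ℚ.⊔-sel (maxUpTo u k) (u (suc k)) | maxUpTo-attained u k
... | inj₁ eq | j , j≤k , eq′ = j , ℕ.m≤n⇒m≤1+n j≤k , trans eq eq′
... | inj₂ eq | _             = suc k , ℕ.≤-refl , eq

-- Walk down from the last node. The first time `r` exceeds the next lower node by more than δ, it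
-- also lies above the current node, because a step `h` is at most δ.
nearest-node : ∀ {h δ} k r → 0ℚ ℚ.≤ δ → h ℚ.≤ δ → 0ℚ ℚ.≤ r ℚ.+ δ → r ℚ.≤ node h k ℚ.+ δ →
  ∃[ j ] j ℕ.≤ k × ℚ.∣ r ℚ.- node h j ∣ ℚ.≤ δ
nearest-node {h} {δ} zero r 0≤δ h≤δ lo hi = zero , z≤n , ∣p∣≤
  (≤-by (p≤q⇒0≤q-p hi)
    (solve 2 (λ r δ → δ :- (r :- con 0ℚ) := con 0ℚ :+ δ :- r) refl r δ))
  (≤-by lo (solve 2 (λ r δ → δ :- (:- (r :- con 0ℚ)) := r :+ δ) refl r δ))
nearest-node {h} {δ} (suc k) r 0≤δ h≤δ lo hi with r ℚ.≤? node h k ℚ.+ δ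
... | yes hi′ = let j , j≤k , close = nearest-node k r 0≤δ h≤δ lo hi′
                in j , ℕ.m≤n⇒m≤1+n j≤k , close
... | no  ¬hi = suc k , ℕ.≤-refl , ∣p∣≤
  (≤-by (p≤q⇒0≤q-p hi)
    (solve 3 (λ r x δ → δ :- (r :- x) := x :+ δ :- r) refl r (node h (suc k)) δ))
  (≤-by (0≤p+q (0≤p+q (p≤q⇒0≤q-p (ℚ.<⇒≤ (ℚ.≰⇒> ¬hi))) (p≤q⇒0≤q-p h≤δ)) 0≤δ)
    (solve 4 (λ r x δ h → δ :- (:- (r :- (x :+ h))) := r :- (x :+ δ) :+ (δ :- h) :+ δ)
      refl r (node h k) δ h))

-- Supremum norms

infix 9 _at_

-- For a polynomial this is the rational polynomial whose coefficients are the `n`-th terms of the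
-- real coefficients.
_at_ : (ℝ → ℝ) → ℕ → ℚ → ℚ
(F at n) r = seq (F (fromℚ r)) n

-- F is computed termwise from the rational functions F at n, which converge
-- locally uniformly; the interval [-2 , 2] leaves room for the approximations
-- of a real in [-1 , 1], which need not lie in [-1 , 1] themselves.
record Regular (F : ℝ → ℝ) : Set where
  field
    pointwise : ∀ x n → seq (F x) n ≡ (F at n) (seq x n)
    bound : ∃[ b ] 0ℚ ℚ.< b × (∃[ N ] ∀ n r → N ℕ.≤ n → ℚ.∣ r ∣ ℚ.≤ 2ℚ →
      ℚ.∣ (F at n) r ∣ ℚ.≤ b)
    continuous : ∀ ε → 0ℚ ℚ.< ε → ∃[ δ ] 0ℚ ℚ.< δ × (∃[ N ] ∀ m n r s →
      N ℕ.≤ m → N ℕ.≤ n → ℚ.∣ r ∣ ℚ.≤ 2ℚ → ℚ.∣ s ∣ ℚ.≤ 2ℚ → ℚ.∣ r ℚ.- s ∣ ℚ.≤ δ →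
      ℚ.∣ (F at m) r ℚ.- (F at n) s ∣ ℚ.≤ ε)

open Regular

-- Closure properties of regular functions

constant-regular : ∀ a → Regular (λ _ → a)
constant-regular a = record
  { pointwise  = λ _ _ → refl
  ; bound      = let b , 0<b , N , a≤b = bounded (seq a) (cauchy a)
                 in b , 0<b , N , λ n _ N≤n _ → a≤b n N≤n
  ; continuous = λ ε 0<ε → let N , close = cauchy a ε 0<ε
                 in 1ℚ , ℚ.positive⁻¹ 1ℚ , N , λ m n _ _ N≤m N≤n _ _ _ → close m n N≤m N≤n
  }

identity-regular : Regular (λ x → x)
identity-regular = record
  { pointwise  = λ _ _ → refl
  ; bound      = 2ℚ , ℚ.positive⁻¹ 2ℚ , 0 , λ _ _ _ r≤2 → r≤2
  ; continuous = λ ε 0<ε → ε , 0<ε , 0 , λ _ _ _ _ _ _ _ _ r-s≤ε → r-s≤ε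
  }

neg-regular : ∀ {F} → Regular F → Regular (λ x → - F x)
neg-regular {F} RF = record
  { pointwise  = λ x n → cong ℚ.-_ (pointwise RF x n)
  ; bound      = let b , 0<b , N , F≤b = bound RF
                 in b , 0<b , N , λ n r N≤n r≤2 →
                      subst (ℚ._≤ b) (sym (ℚ.∣-p∣≡∣p∣ ((F at n) r))) (F≤b n r N≤n r≤2)
  ; continuous = λ ε 0<ε → let δ , 0<δ , N , close = continuous RF ε 0<ε
                 in δ , 0<δ , N , λ m n r s N≤m N≤n r≤2 s≤2 r-s≤δ →
                      subst (ℚ._≤ ε)
                        (trans (∣p-q∣≡∣q-p∣ ((F at m) r) ((F at n) s))
                          (cong ℚ.∣_∣ (q-p≡-p--q ((F at m) r) ((F at n) s))))
                        (close m n r s N≤m N≤n r≤2 s≤2 r-s≤δ)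
  }

0<p⊓q : ∀ {p q} → 0ℚ ℚ.< p → 0ℚ ℚ.< q → 0ℚ ℚ.< p ℚ.⊓ q
0<p⊓q {p} {q} 0<p 0<q with ℚ.⊓-sel p q
... | inj₁ eq = subst (0ℚ ℚ.<_) (sym eq) 0<p
... | inj₂ eq = subst (0ℚ ℚ.<_) (sym eq) 0<q

continuous₂ : ∀ {F G} → Regular F → Regular G → ∀ α β → 0ℚ ℚ.< α → 0ℚ ℚ.< β →
  ∃[ δ ] 0ℚ ℚ.< δ × (∃[ N ] ∀ m n r s →
    N ℕ.≤ m → N ℕ.≤ n → ℚ.∣ r ∣ ℚ.≤ 2ℚ → ℚ.∣ s ∣ ℚ.≤ 2ℚ → ℚ.∣ r ℚ.- s ∣ ℚ.≤ δ →
    ℚ.∣ (F at m) r ℚ.- (F at n) s ∣ ℚ.≤ α × ℚ.∣ (G at m) r ℚ.- (G at n) s ∣ ℚ.≤ β)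
continuous₂ RF RG α β 0<α 0<β =
  let δ , 0<δ , M , closeF = continuous RF α 0<α
      γ , 0<γ , N , closeG = continuous RG β 0<β
  in δ ℚ.⊓ γ , 0<p⊓q 0<δ 0<γ , M ℕ.⊔ N , λ m n r s p q r≤2 s≤2 r-s≤ →
      closeF m n r s (ℕ.m⊔n≤o⇒m≤o M N p) (ℕ.m⊔n≤o⇒m≤o M N q) r≤2 s≤2
        (ℚ.≤-trans r-s≤ (ℚ.p⊓q≤p δ γ))
    , closeG m n r s (ℕ.m⊔n≤o⇒n≤o M N p) (ℕ.m⊔n≤o⇒n≤o M N q) r≤2 s≤2
        (ℚ.≤-trans r-s≤ (ℚ.p⊓q≤q δ γ))

+-regular : ∀ {F G} → Regular F → Regular G → Regular (λ x → F x + G x)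
+-regular {F} {G} RF RG = record
  { pointwise  = λ x n → cong₂ ℚ._+_ (pointwise RF x n) (pointwise RG x n)
  ; bound      =
      let a , 0<a , M , F≤a = bound RF
          b , 0<b , N , G≤b = bound RG
      in a ℚ.+ b , ℚ.+-mono-< 0<a 0<b , M ℕ.⊔ N , λ n r p r≤2 →
           ℚ.≤-trans (ℚ.∣p+q∣≤∣p∣+∣q∣ ((F at n) r) ((G at n) r))
             (ℚ.+-mono-≤ (F≤a n r (ℕ.m⊔n≤o⇒m≤o M N p) r≤2) (G≤b n r (ℕ.m⊔n≤o⇒n≤o M N p) r≤2))
  ; continuous = λ ε 0<ε →
      let δ , 0<δ , N , close = continuous₂ RF RG (½ ℚ.* ε) (½ ℚ.* ε) (0<½*ε 0<ε) (0<½*ε 0<ε)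
      in δ , 0<δ , N , λ m n r s p q r≤2 s≤2 r-s≤δ →
           let Fε , Gε = close m n r s p q r≤2 s≤2 r-s≤δ
               f = (F at m) r
               g = (G at m) r
               f′ = (F at n) s
               g′ = (G at n) s
           in begin
             ℚ.∣ (f ℚ.+ g) ℚ.- (f′ ℚ.+ g′) ∣      ≡⟨ cong ℚ.∣_∣ (+-diff f g f′ g′) ⟩
             ℚ.∣ (f ℚ.- f′) ℚ.+ (g ℚ.- g′) ∣      ≤⟨ ℚ.∣p+q∣≤∣p∣+∣q∣ (f ℚ.- f′) (g ℚ.- g′) ⟩
             ℚ.∣ f ℚ.- f′ ∣ ℚ.+ ℚ.∣ g ℚ.- g′ ∣    ≤⟨ ℚ.+-mono-≤ Fε Gε ⟩
             ½ ℚ.* ε ℚ.+ ½ ℚ.* ε                  ≡⟨ ½*ε+½*ε≡ε ε ⟩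
             ε                                    ∎
  }
  where open ℚ.≤-Reasoning

*-regular : ∀ {F G} → Regular F → Regular G → Regular (λ x → F x * G x)
*-regular {F} {G} RF RG = record
  { pointwise  = λ x n → cong₂ ℚ._*_ (pointwise RF x n) (pointwise RG x n)
  ; bound      =
      let a , 0<a , M , F≤a = bound RF
          b , 0<b , N , G≤b = bound RG
      in a ℚ.* b
       , ℚ.positive⁻¹ (a ℚ.* b) {{ℚ.pos*pos⇒pos a {{ℚ.positive 0<a}} b {{ℚ.positive 0<b}}}}
       , M ℕ.⊔ N , λ n r p r≤2 →
           ∣p*q∣≤ {(F at n) r} {(G at n) r}
             (F≤a n r (ℕ.m⊔n≤o⇒m≤o M N p) r≤2) (G≤b n r (ℕ.m⊔n≤o⇒n≤o M N p) r≤2)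
  ; continuous = λ ε 0<ε →
      let a , 0<a , A , F≤a = bound RF
          b , 0<b , B , G≤b = bound RG
          -- Since |fg - f′g′| ≤ |f||g - g′| + |g′||f - f′|, the tolerance for each factor is ε/2
          -- divided by the bound of the other factor.
          α , 0<α , bα≡½ε = shrink 0<b (0<½*ε 0<ε)
          β , 0<β , aβ≡½ε = shrink 0<a (0<½*ε 0<ε)
          δ , 0<δ , N , close = continuous₂ RF RG α β 0<α 0<β
      in δ , 0<δ , (A ℕ.⊔ B) ℕ.⊔ N , λ m n r s p q r≤2 s≤2 r-s≤δ →
           let Fα , Gβ = close m n r s
                 (ℕ.m⊔n≤o⇒n≤o (A ℕ.⊔ B) N p) (ℕ.m⊔n≤o⇒n≤o (A ℕ.⊔ B) N q) r≤2 s≤2 r-s≤δ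
               f = (F at m) r
               g = (G at m) r
               f′ = (F at n) s
               g′ = (G at n) s
           in begin
             ℚ.∣ f ℚ.* g ℚ.- f′ ℚ.* g′ ∣
               ≡⟨ cong ℚ.∣_∣ (*-diff f g f′ g′) ⟩
             ℚ.∣ f ℚ.* (g ℚ.- g′) ℚ.+ g′ ℚ.* (f ℚ.- f′) ∣
               ≤⟨ ℚ.∣p+q∣≤∣p∣+∣q∣ (f ℚ.* (g ℚ.- g′)) (g′ ℚ.* (f ℚ.- f′)) ⟩
             ℚ.∣ f ℚ.* (g ℚ.- g′) ∣ ℚ.+ ℚ.∣ g′ ℚ.* (f ℚ.- f′) ∣
               ≤⟨ ℚ.+-mono-≤
                    (∣p*q∣≤ {f} {g ℚ.- g′}
                      (F≤a m r (ℕ.m⊔n≤o⇒m≤o A B (ℕ.m⊔n≤o⇒m≤o (A ℕ.⊔ B) N p)) r≤2) Gβ)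
                    (∣p*q∣≤ {g′} {f ℚ.- f′}
                      (G≤b n s (ℕ.m⊔n≤o⇒n≤o A B (ℕ.m⊔n≤o⇒m≤o (A ℕ.⊔ B) N q)) s≤2) Fα) ⟩
             a ℚ.* β ℚ.+ b ℚ.* α      ≡⟨ cong₂ ℚ._+_ aβ≡½ε bα≡½ε ⟩
             ½ ℚ.* ε ℚ.+ ½ ℚ.* ε      ≡⟨ ½*ε+½*ε≡ε ε ⟩
             ε                        ∎
  }
  where open ℚ.≤-Reasoning

regular-ext : ∀ {F G} → (∀ x n → seq (F x) n ≡ seq (G x) n) → Regular F → Regular G
regular-ext {F} {G} F≗G RF = record
  { pointwise  = λ x n → trans (sym (F≗G x n)) (trans (pointwise RF x n) (F≗G _ n))
  ; bound      = let b , 0<b , N , F≤b = bound RF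
                 in b , 0<b , N , λ n r N≤n r≤2 →
                      subst (λ t → ℚ.∣ t ∣ ℚ.≤ b) (F≗G _ n) (F≤b n r N≤n r≤2)
  ; continuous = λ ε 0<ε → let δ , 0<δ , N , close = continuous RF ε 0<ε
                 in δ , 0<δ , N , λ m n r s N≤m N≤n r≤2 s≤2 r-s≤δ →
                      subst₂ (λ t u → ℚ.∣ t ℚ.- u ∣ ℚ.≤ ε) (F≗G _ m) (F≗G _ n)
                        (close m n r s N≤m N≤n r≤2 s≤2 r-s≤δ)
  }

horner : ∀ {k} → Vec ℝ k → ℝ → ℝ
horner p x = foldr′ (λ a r → a + x * r) 0ℝ p

-- Real numbers are compared through their sequences only: unfolding the
-- Cauchy moduli of a + x * r is prohibitively expensive.
horner-regular : ∀ {k} (p : Vec ℝ k) → Regular (horner p)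
horner-regular []      = regular-ext {λ _ → 0ℝ} (λ _ _ → refl) (constant-regular 0ℝ)
horner-regular (a ∷ p) = regular-ext {λ x → a + x * horner p x} (λ _ _ → refl)
  (+-regular {λ _ → a} {λ x → x * horner p x} (constant-regular a)
    (*-regular {λ x → x} {horner p} identity-regular (horner-regular p)))

difference-regular : ∀ {k l} (p : Poly≤ k) (q : Poly≤ l) → Regular (λ x → ⟦ p ⟧ x - ⟦ q ⟧ x)
difference-regular p q = +-regular {⟦ p ⟧} {λ x → - ⟦ q ⟧ x} (horner-regular p)
  (neg-regular {⟦ q ⟧} (horner-regular q))

-- 2n + 2 steps of length 1/(n+1) lead from -1 to 1.
mesh : ℕ → ℚ
mesh n = 1/n (suc n)

gridPoint : ℕ → ℕ → ℚ
gridPoint n j = node (mesh n) j ℚ.- 1ℚ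

lastIndex : ℕ → ℕ
lastIndex n = suc n ℕ.+ suc n

node-lastIndex : ∀ n → node (mesh n) (lastIndex n) ≡ 2ℚ
node-lastIndex n = trans (node-+ (mesh n) (suc n) (suc n))
  (cong₂ ℚ._+_ (node-1/n (suc n)) (node-1/n (suc n)))

∣gridPoint∣≤1 : ∀ n {j} → j ℕ.≤ lastIndex n → ℚ.∣ gridPoint n j ∣ ℚ.≤ 1ℚ
∣gridPoint∣≤1 n {j} j≤ = ∣p∣≤
  (≤-by (p≤q⇒0≤q-p (subst (x ℚ.≤_) (node-lastIndex n) (node-mono-≤ (0≤1/n (suc n)) j≤)))
    (solve 1 (λ x → con 1ℚ :- (x :- con 1ℚ) := con 2ℚ :- x) refl x))
  (≤-by (node-mono-≤ (0≤1/n (suc n)) (z≤n {j}))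
    (solve 1 (λ x → con 1ℚ :- (:- (x :- con 1ℚ)) := x) refl x))
  where x = node (mesh n) j

1≤2ℚ : 1ℚ ℚ.≤ 2ℚ
1≤2ℚ = ℚ.≤ᵇ⇒≤ _

-- The case `r = s` of joint continuity.
uniformlyCauchy : ∀ {F} → Regular F → ∀ ε → 0ℚ ℚ.< ε → ∃[ N ] ∀ m n r →
  N ℕ.≤ m → N ℕ.≤ n → ℚ.∣ r ∣ ℚ.≤ 1ℚ → ℚ.∣ (F at m) r ℚ.- (F at n) r ∣ ℚ.≤ ε
uniformlyCauchy RF ε 0<ε =
  let δ , 0<δ , N , close = continuous RF ε 0<ε
  in N , λ m n r N≤m N≤n r≤1 →
    let r≤2 = ℚ.≤-trans r≤1 1≤2ℚ
    in close m n r r N≤m N≤n r≤2 r≤2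
         (subst (λ t → ℚ.∣ t ∣ ℚ.≤ δ) (sym (ℚ.+-inverseʳ r)) (ℚ.<⇒≤ 0<δ))

p≤q+ε : ∀ {p q ε} → p ℚ.≤ q → 0ℚ ℚ.< ε → p ℚ.≤ q ℚ.+ ε
p≤q+ε {p} p≤q 0<ε = subst (ℚ._≤ _) (ℚ.+-identityʳ p) (ℚ.+-mono-≤ p≤q (ℚ.<⇒≤ 0<ε))

fromℚ≤1 : ∀ r → ℚ.∣ r ∣ ℚ.≤ 1ℚ → fromℚ r ≤ 1ℝ
fromℚ≤1 r r≤1 ε 0<ε = 0 , λ _ _ → p≤q+ε (ℚ.≤-trans (p≤∣p∣ r) r≤1) 0<ε

-1≤fromℚ : ∀ r → ℚ.∣ r ∣ ℚ.≤ 1ℚ → - 1ℝ ≤ fromℚ r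
-1≤fromℚ r r≤1 ε 0<ε = 0 , λ _ _ → p≤q+ε {ℚ.- 1ℚ} {r}
  (≤-by (p≤q⇒0≤q-p (ℚ.≤-trans (-p≤∣p∣ r) r≤1))
    (solve 1 (λ r → r :- (:- con 1ℚ) := con 1ℚ :- (:- r)) refl r)) 0<ε

boundedBy-at : ∀ {F b} → BoundedBy F b → ∀ r → ℚ.∣ r ∣ ℚ.≤ 1ℚ → ∀ ε → 0ℚ ℚ.< ε →
  ∃[ N ] ∀ n → N ℕ.≤ n → ℚ.∣ (F at n) r ∣ ℚ.≤ seq b n ℚ.+ ε
boundedBy-at F≤b r r≤1 = F≤b (fromℚ r) (-1≤fromℚ r r≤1) (fromℚ≤1 r r≤1)

-- The supremum norm as a limit of maxima over finer and finer grids

module SupNorm {F : ℝ → ℝ} (RF : Regular F) where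

  -- The precision of the values and the mesh of the grid are refined together, so a single index
  -- gives the terms of a real number.
  gridNorm : ℕ → ℚ
  gridNorm n = maxUpTo (λ j → ℚ.∣ (F at n) (gridPoint n j) ∣) (lastIndex n)

  gridNorm-attained : ∀ n → ∃[ r ] ℚ.∣ r ∣ ℚ.≤ 1ℚ × gridNorm n ≡ ℚ.∣ (F at n) r ∣
  gridNorm-attained n =
    let j , j≤ , eq = maxUpTo-attained _ (lastIndex n)
    in gridPoint n j , ∣gridPoint∣≤1 n j≤ , eq

  -- Replace `r` by a nearby grid point and apply continuity. The margin δ around [-1 , 1] admits
  -- the terms of a real in the interval, as `supNorm-bound` requires.
  ∣at∣≤gridNorm : ∀ ε → 0ℚ ℚ.< ε → ∃[ δ ] 0ℚ ℚ.< δ × (∃[ N ] ∀ m n r →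
    N ℕ.≤ m → N ℕ.≤ n → r ℚ.≤ 1ℚ ℚ.+ δ → ℚ.- r ℚ.≤ 1ℚ ℚ.+ δ →
    ℚ.∣ (F at m) r ∣ ℚ.≤ gridNorm n ℚ.+ ε)
  ∣at∣≤gridNorm ε 0<ε =
    let γ , 0<γ , M , close = continuous RF ε 0<ε
        -- The cap at 1 keeps `r` inside [-2 , 2], where `continuous` applies.
        δ = γ ℚ.⊓ 1ℚ
        0<δ = 0<p⊓q 0<γ (ℚ.positive⁻¹ 1ℚ)
        N , mesh≤ = archimedean 0<δ
    in δ , 0<δ , M ℕ.⊔ N , λ m n r p q r≤ -r≤ →
      let 1+δ≤2 = ℚ.+-monoʳ-≤ 1ℚ (ℚ.p⊓q≤q γ 1ℚ)
          j , j≤ , near = nearest-node (lastIndex n) (r ℚ.+ 1ℚ) (ℚ.<⇒≤ 0<δ)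
            (mesh≤ n (ℕ.m⊔n≤o⇒n≤o M N q))
            (subst (0ℚ ℚ.≤_)
              (solve 2 (λ r δ → con 1ℚ :+ δ :- (:- r) := r :+ con 1ℚ :+ δ) refl r δ)
              (p≤q⇒0≤q-p -r≤))
            (subst (λ t → r ℚ.+ 1ℚ ℚ.≤ t ℚ.+ δ) (sym (node-lastIndex n))
              (≤-by (p≤q⇒0≤q-p r≤)
                (solve 2 (λ r δ → con 2ℚ :+ δ :- (r :+ con 1ℚ) := con 1ℚ :+ δ :- r) refl r δ)))
          s = gridPoint n j
          near′ = subst (λ t → ℚ.∣ t ∣ ℚ.≤ δ)
            (solve 2 (λ r x → r :+ con 1ℚ :- x := r :- (x :- con 1ℚ)) refl r (node (mesh n) j))
            near
      in ℚ.≤-trans (∣p∣≤∣q∣+∣p-q∣ ((F at m) r) ((F at n) s))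
           (ℚ.+-mono-≤ (≤maxUpTo _ j≤)
             (close m n r s (ℕ.m⊔n≤o⇒m≤o M N p) (ℕ.m⊔n≤o⇒m≤o M N q)
               (∣p∣≤ (ℚ.≤-trans r≤ 1+δ≤2) (ℚ.≤-trans -r≤ 1+δ≤2))
               (ℚ.≤-trans (∣gridPoint∣≤1 n j≤) 1≤2ℚ)
               (ℚ.≤-trans near′ (ℚ.p⊓q≤p γ 1ℚ))))

  ∣at∣≤gridNorm-inside : ∀ ε → 0ℚ ℚ.< ε → ∃[ N ] ∀ m n r →
    N ℕ.≤ m → N ℕ.≤ n → ℚ.∣ r ∣ ℚ.≤ 1ℚ → ℚ.∣ (F at m) r ∣ ℚ.≤ gridNorm n ℚ.+ ε
  ∣at∣≤gridNorm-inside ε 0<ε =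
    let δ , 0<δ , N , near = ∣at∣≤gridNorm ε 0<ε
    in N , λ m n r N≤m N≤n r≤1 → near m n r N≤m N≤n
         (p≤q+ε (ℚ.≤-trans (p≤∣p∣ r) r≤1) 0<δ)
         (p≤q+ε (ℚ.≤-trans (-p≤∣p∣ r) r≤1) 0<δ)

  gridNorm-step : ∀ ε → 0ℚ ℚ.< ε → ∃[ N ] ∀ m n → N ℕ.≤ m → N ℕ.≤ n →
    gridNorm m ℚ.≤ gridNorm n ℚ.+ ε
  gridNorm-step ε 0<ε =
    let N , near = ∣at∣≤gridNorm-inside ε 0<ε
    in N , λ m n N≤m N≤n →
      let r , r≤1 , eq = gridNorm-attained m
      in subst (ℚ._≤ gridNorm n ℚ.+ ε) (sym eq) (near m n r N≤m N≤n r≤1)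

  supNorm : ℝ
  supNorm = mkℝ gridNorm λ ε 0<ε →
    let N , step = gridNorm-step ε 0<ε
    in N , λ m n N≤m N≤n → ∣p∣≤
      (≤-by (p≤q⇒0≤q-p (step m n N≤m N≤n))
        (solve 3 (λ a b ε → ε :- (a :- b) := b :+ ε :- a) refl (gridNorm m) (gridNorm n) ε))
      (≤-by (p≤q⇒0≤q-p (step n m N≤n N≤m))
        (solve 3 (λ a b ε → ε :- (:- (a :- b)) := a :+ ε :- b) refl (gridNorm m) (gridNorm n) ε))

  supNorm-bound : BoundedBy F supNorm
  supNorm-bound x -1≤x x≤1 ε 0<ε =
    let δ , 0<δ , N , near = ∣at∣≤gridNorm ε 0<ε
        A , lo = -1≤x δ 0<δ
        B , hi = x≤1 δ 0<δ
    in (A ℕ.⊔ B) ℕ.⊔ N , λ n p →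
      let A⊔B≤n = ℕ.m⊔n≤o⇒m≤o (A ℕ.⊔ B) N p
          N≤n = ℕ.m⊔n≤o⇒n≤o (A ℕ.⊔ B) N p
          r = seq x n
      in subst (λ t → ℚ.∣ t ∣ ℚ.≤ gridNorm n ℚ.+ ε) (sym (pointwise RF x n))
           (near n n r N≤n N≤n (hi n (ℕ.m⊔n≤o⇒n≤o A B A⊔B≤n))
             (≤-by (p≤q⇒0≤q-p (lo n (ℕ.m⊔n≤o⇒m≤o A B A⊔B≤n)))
               (solve 2 (λ r δ → con 1ℚ :+ δ :- (:- r) := r :+ δ :- (:- con 1ℚ)) refl r δ)))

  -- The bound by `b` at a point holds only from an index that depends on the point, while the
  -- maximising grid point changes with `n`. So one index `k` is fixed and its maximiser `r` is kept
  -- for all later `n`. The costs are η for changing the grid, θ for changing the approximation at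
  -- `r` and θ for the bound by `b`, in total ε.
  supNorm-least : ∀ b → BoundedBy F b → supNorm ≤ b
  supNorm-least b F≤b ε 0<ε = M ℕ.⊔ N ℕ.⊔ A , bounds
    where
    open ℚ.≤-Reasoning
    η θ : ℚ
    η = ½ ℚ.* ε
    θ = ½ ℚ.* η
    0<η : 0ℚ ℚ.< η
    0<η = 0<½*ε 0<ε
    0<θ : 0ℚ ℚ.< θ
    0<θ = 0<½*ε 0<η
    gridNorm-stable : ∃[ M ] ∀ m n → M ℕ.≤ m → M ℕ.≤ n → gridNorm m ℚ.≤ gridNorm n ℚ.+ η
    gridNorm-stable = gridNorm-step η 0<η
    F-stable : ∃[ N ] ∀ m n r → N ℕ.≤ m → N ℕ.≤ n → ℚ.∣ r ∣ ℚ.≤ 1ℚ →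
      ℚ.∣ (F at m) r ℚ.- (F at n) r ∣ ℚ.≤ θ
    F-stable = uniformlyCauchy RF θ 0<θ
    M N k : ℕ
    M = proj₁ gridNorm-stable
    N = proj₁ F-stable
    k = M ℕ.⊔ N
    maximiser : ∃[ r ] ℚ.∣ r ∣ ℚ.≤ 1ℚ × gridNorm k ≡ ℚ.∣ (F at k) r ∣
    maximiser = gridNorm-attained k
    r : ℚ
    r = proj₁ maximiser
    r≤1 : ℚ.∣ r ∣ ℚ.≤ 1ℚ
    r≤1 = proj₁ (proj₂ maximiser)
    bounded-at-r : ∃[ A ] ∀ n → A ℕ.≤ n → ℚ.∣ (F at n) r ∣ ℚ.≤ seq b n ℚ.+ θ
    bounded-at-r = boundedBy-at {F} {b} F≤b r r≤1 θ 0<θ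
    A : ℕ
    A = proj₁ bounded-at-r
    bounds : ∀ n → k ℕ.⊔ A ℕ.≤ n → gridNorm n ℚ.≤ seq b n ℚ.+ ε
    bounds n k⊔A≤n = begin
      gridNorm n
        ≤⟨ proj₂ gridNorm-stable n k (ℕ.m⊔n≤o⇒m≤o M N k≤n) (ℕ.m≤m⊔n M N) ⟩
      gridNorm k ℚ.+ η
        ≡⟨ cong (ℚ._+ η) (proj₂ (proj₂ maximiser)) ⟩
      ℚ.∣ (F at k) r ∣ ℚ.+ η
        ≤⟨ ℚ.+-monoˡ-≤ η (∣p∣≤∣q∣+∣p-q∣ ((F at k) r) ((F at n) r)) ⟩
      ℚ.∣ (F at n) r ∣ ℚ.+ ℚ.∣ (F at k) r ℚ.- (F at n) r ∣ ℚ.+ η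
        ≤⟨ ℚ.+-monoˡ-≤ η (ℚ.+-mono-≤
             (proj₂ bounded-at-r n (ℕ.m⊔n≤o⇒n≤o k A k⊔A≤n))
             (proj₂ F-stable k n r (ℕ.m≤n⊔m M N) (ℕ.m⊔n≤o⇒n≤o M N k≤n) r≤1)) ⟩
      seq b n ℚ.+ θ ℚ.+ θ ℚ.+ η
        ≡⟨ solve 2 (λ b ε → b :+ con ½ :* (con ½ :* ε) :+ con ½ :* (con ½ :* ε) :+ con ½ :* ε
                      := b :+ ε) refl (seq b n) ε ⟩
      seq b n ℚ.+ ε ∎
      where
      k≤n : k ℕ.≤ n
      k≤n = ℕ.m⊔n≤o⇒m≤o k A k⊔A≤n

  isSupNorm : IsSupNorm F supNorm
  isSupNorm = supNorm-bound , supNorm-least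

  -- This and `≤∣at∣⇒≤norm` turn statements about norms into inequalities between rationals.
  ∣at∣≤⇒norm≤ : ∀ {t} → (∀ n r → ℚ.∣ r ∣ ℚ.≤ 1ℚ → ℚ.∣ (F at n) r ∣ ℚ.≤ seq t n) → ‖ F ‖∞≤ t
  ∣at∣≤⇒norm≤ {t} F≤t = supNorm , isSupNorm , λ ε 0<ε → 0 , λ n _ →
    let r , r≤1 , eq = gridNorm-attained n
    in p≤q+ε (subst (ℚ._≤ seq t n) (sym eq) (F≤t n r r≤1)) 0<ε

  ≤∣at∣⇒≤norm : ∀ {t N r} → ℚ.∣ r ∣ ℚ.≤ 1ℚ → (∀ n → N ℕ.≤ n → seq t n ℚ.≤ ℚ.∣ (F at n) r ∣) →
    ‖ F ‖∞≥ t
  ≤∣at∣⇒≤norm {t} {N} {r} r≤1 t≤F = supNorm , isSupNorm , λ ε 0<ε →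
    let M , F≤ = boundedBy-at {F} {supNorm} supNorm-bound r r≤1 ε 0<ε
    in N ℕ.⊔ M , λ n p →
      ℚ.≤-trans (t≤F n (ℕ.m⊔n≤o⇒m≤o N M p)) (F≤ n (ℕ.m⊔n≤o⇒n≤o N M p))

module _ {k l} (p : Poly≤ k) (q : Poly≤ l) where

  open SupNorm {λ x → ⟦ p ⟧ x - ⟦ q ⟧ x} (difference-regular p q)

  difference-norm≤ : ∀ t →
    (∀ n r → ℚ.∣ r ∣ ℚ.≤ 1ℚ → ℚ.∣ (⟦ p ⟧ at n) r ℚ.- (⟦ q ⟧ at n) r ∣ ℚ.≤ seq t n) →
    ‖ (λ x → ⟦ p ⟧ x - ⟦ q ⟧ x) ‖∞≤ t
  difference-norm≤ t = ∣at∣≤⇒norm≤ {t}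

  difference-norm≥ : ∀ t {N r} → ℚ.∣ r ∣ ℚ.≤ 1ℚ →
    (∀ n → N ℕ.≤ n → seq t n ℚ.≤ ℚ.∣ (⟦ p ⟧ at n) r ℚ.- (⟦ q ⟧ at n) r ∣) →
    ‖ (λ x → ⟦ p ⟧ x - ⟦ q ⟧ x) ‖∞≥ t
  difference-norm≥ t {N} {r} = ≤∣at∣⇒≤norm {t} {N} {r}

-- Finite differences

-- With this orientation, `sign j` times `Δ u j` is the sum of `sign j` times `u j` and
-- `sign (suc j)` times `u (suc j)`.
Δ : (ℕ → ℚ) → ℕ → ℚ
Δ u j = u j ℚ.- u (suc j)

Annihilated : ℕ → (ℕ → ℚ) → Set
Annihilated zero    u = ∀ j → u j ≡ 0ℚ
Annihilated (suc k) u = Annihilated k (Δ u)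

annihilated-ext : ∀ k {u v} → (∀ j → u j ≡ v j) → Annihilated k u → Annihilated k v
annihilated-ext zero    u≗v Au j = trans (sym (u≗v j)) (Au j)
annihilated-ext (suc k) u≗v Au =
  annihilated-ext k (λ j → cong₂ ℚ._-_ (u≗v j) (u≗v (suc j))) Au

annihilated-0 : ∀ k → Annihilated k (λ _ → 0ℚ)
annihilated-0 zero    j = refl
annihilated-0 (suc k) = annihilated-0 k

annihilated-shift : ∀ k {u} → Annihilated k u → Annihilated k (λ j → u (suc j))
annihilated-shift zero    Au j = Au (suc j)
annihilated-shift (suc k) Au = annihilated-shift k Au

annihilated-+ : ∀ k {u v} → Annihilated k u → Annihilated k v →
  Annihilated k (λ j → u j ℚ.+ v j)
annihilated-+ zero    Au Av j = cong₂ ℚ._+_ (Au j) (Av j)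
annihilated-+ (suc k) {u} {v} Au Av = annihilated-ext k
  (λ j → sym (+-diff (u j) (v j) (u (suc j)) (v (suc j)))) (annihilated-+ k Au Av)

annihilated-scale : ∀ k {u} c → Annihilated k u → Annihilated k (λ j → c ℚ.* u j)
annihilated-scale zero    c Au j = trans (cong (c ℚ.*_) (Au j)) (ℚ.*-zeroʳ c)
annihilated-scale (suc k) {u} c Au = annihilated-ext k
  (λ j → solve 3 (λ c a b → c :* (a :- b) := c :* a :- c :* b) refl c (u j) (u (suc j)))
  (annihilated-scale k c Au)

-- A discrete product rule: writing x for the nodes, Δ(xu) at j is x_j times Δu at j, minus h times
-- u at j + 1. The first term leads back to the lemma with `k` lowered by one.
annihilated-node : ∀ k {u} h → Annihilated k u → Annihilated (suc k) (λ j → node h j ℚ.* u j)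
annihilated-node k {u} h Au = annihilated-ext k
  (λ j → solve 4 (λ x h a b → x :* (a :- b) :+ (:- h) :* b := x :* a :- (x :+ h) :* b)
    refl (node h j) h (u j) (u (suc j)))
  (annihilated-+ k (node-Δ k Au) (annihilated-scale k (ℚ.- h) (annihilated-shift k Au)))
  where
  node-Δ : ∀ k {u} → Annihilated k u → Annihilated k (λ j → node h j ℚ.* Δ u j)
  node-Δ zero {u} Au j = trans (cong (node h j ℚ.*_) (cong₂ ℚ._-_ (Au j) (Au (suc j))))
    (ℚ.*-zeroʳ (node h j))
  node-Δ (suc k)  Au   = annihilated-node k h Au

annihilated-constant : ∀ k c → Annihilated (suc k) (λ _ → c)
annihilated-constant k c = annihilated-ext k (λ _ → sym (ℚ.+-inverseʳ c)) (annihilated-0 k)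

-- A vector of `k` coefficients has degree below `k`: the empty vector is the zero polynomial, and
-- each Horner step multiplies by the node and adds a constant.
horner-annihilated : ∀ {k} (p : Vec ℝ k) h n →
  Annihilated k (λ j → (horner p at n) (node h j))
horner-annihilated []            h n = λ _ → refl
horner-annihilated (_∷_ {k} a p) h n = annihilated-+ (suc k)
  {λ _ → seq a n} {λ j → node h j ℚ.* (horner p at n) (node h j)}
  (annihilated-constant k (seq a n))
  (annihilated-node k h (horner-annihilated p h n))

-- Signs and alternation

sign : ℕ → ℚ
sign zero    = 1ℚ
sign (suc j) = ℚ.- sign j

sign≡±1 : ∀ j → sign j ≡ 1ℚ ⊎ sign j ≡ ℚ.- 1ℚ
sign≡±1 zero = inj₁ refl
sign≡±1 (suc j) with sign≡±1 j
... | inj₁ eq = inj₂ (cong ℚ.-_ eq)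
... | inj₂ eq = inj₁ (cong ℚ.-_ eq)

sign*sign : ∀ j → sign j ℚ.* sign j ≡ 1ℚ
sign*sign j with sign j | sign≡±1 j
... | _ | inj₁ refl = refl
... | _ | inj₂ refl = refl

-sign*≤∣∣ : ∀ j p → ℚ.- (sign j ℚ.* p) ℚ.≤ ℚ.∣ p ∣
-sign*≤∣∣ j p with sign j | sign≡±1 j
... | _ | inj₁ refl = subst (ℚ._≤ ℚ.∣ p ∣)
  (solve 1 (λ p → :- p := :- (con 1ℚ :* p)) refl p) (-p≤∣p∣ p)
... | _ | inj₂ refl = subst (ℚ._≤ ℚ.∣ p ∣)
  (solve 1 (λ p → p := :- ((:- con 1ℚ) :* p)) refl p) (p≤∣p∣ p)

sign*≤∣∣ : ∀ j p → sign j ℚ.* p ℚ.≤ ℚ.∣ p ∣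
sign*≤∣∣ j p = subst (ℚ._≤ ℚ.∣ p ∣)
  (solve 2 (λ s p → :- (:- s :* p) := s :* p) refl (sign j) p) (-sign*≤∣∣ (suc j) p)

-- Comparing a rational with 0 decides the alternative. Cauchy reals offer no such decision, hence
-- the passage to a rational approximation of the polynomial.
p+q≤0⇒p≤0∨q≤0 : ∀ {p q} → p ℚ.+ q ℚ.≤ 0ℚ → p ℚ.≤ 0ℚ ⊎ q ℚ.≤ 0ℚ
p+q≤0⇒p≤0∨q≤0 {p} {q} p+q≤0 with ℚ.≤-total p 0ℚ
... | inj₁ p≤0 = inj₁ p≤0
... | inj₂ 0≤p = inj₂ (≤-by (0≤p+q 0≤p (p≤q⇒0≤q-p p+q≤0))
  (solve 2 (λ p q → con 0ℚ :- q := p :+ (con 0ℚ :- (p :+ q))) refl p q))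

-- If u alternated in sign at 0, …, k then so would Δ u at 0, …, k - 1.
¬alternating : ∀ k {u} → Annihilated k u → ∃[ j ] j ℕ.≤ k × sign j ℚ.* u j ℚ.≤ 0ℚ
¬alternating zero {u} Au = zero , z≤n ,
  ℚ.≤-reflexive (trans (ℚ.*-identityˡ (u 0)) (Au 0))
¬alternating (suc k) {u} Au with ¬alternating k Au
... | j , j≤k , sΔu≤0 with p+q≤0⇒p≤0∨q≤0 (subst (ℚ._≤ 0ℚ)
  (solve 3 (λ s a b → s :* (a :- b) := s :* a :+ (:- s) :* b) refl (sign j) (u j) (u (suc j)))
  sΔu≤0)
...   | inj₁ su≤0  = j , ℕ.m≤n⇒m≤1+n j≤k , su≤0
...   | inj₂ su≤0′ = suc j , s≤s j≤k , su≤0′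

-- The family of parabolas

-- The largest excess η for which two caps with centres `h` apart have sum at most 2; equality holds
-- midway between the centres.
height : ℚ → ℚ
height h = ⅛ ℚ.* (h ℚ.* h)

cap : ℚ → ℚ → ℚ
cap η u = 1ℚ ℚ.+ η ℚ.- ½ ℚ.* (u ℚ.* u)

-- The signed cap centred at the node, expanded in powers of the variable; `cap` is even, so its
-- value at `x` serves for the constant coefficient.
parabola : ℚ → ℕ → Poly≤ 2
parabola h j = fromℚ (s ℚ.* cap (height h) x) ∷ fromℚ (s ℚ.* x) ∷ fromℚ (ℚ.- (½ ℚ.* s)) ∷ []
  where
  s = sign j
  x = node h j

parabola-at : ∀ h j n r → (⟦ parabola h j ⟧ at n) r ≡ sign j ℚ.* cap (height h) (r ℚ.- node h j)
parabola-at h j n r = solve 4 (λ s η x r →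
    s :* (con 1ℚ :+ η :- con ½ :* (x :* x)) :+ r :* (s :* x :+ r :* (:- (con ½ :* s) :+ r :* con 0ℚ))
    := s :* (con 1ℚ :+ η :- con ½ :* ((r :- x) :* (r :- x))))
  refl (sign j) (height h) (node h j) r

∣u∣≤2⇒0≤4-u*u : ∀ {u} → ℚ.∣ u ∣ ℚ.≤ 2ℚ → 0ℚ ℚ.≤ (2ℚ ℚ.- u) ℚ.* (2ℚ ℚ.- ℚ.- u)
∣u∣≤2⇒0≤4-u*u {u} u≤2 = 0≤p*q (p≤q⇒0≤q-p (ℚ.≤-trans (p≤∣p∣ u) u≤2))
                              (p≤q⇒0≤q-p (ℚ.≤-trans (-p≤∣p∣ u) u≤2))

-- The excess η cancels and leaves (v² - u²)/2, which is at most 4/2.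
cap-same : ∀ η u v → ℚ.∣ u ∣ ℚ.≤ 2ℚ → ℚ.∣ v ∣ ℚ.≤ 2ℚ → ℚ.∣ cap η u ℚ.- cap η v ∣ ℚ.≤ 2ℚ
cap-same η u v u≤2 v≤2 = ∣p∣≤ (oneSided u v v≤2)
  (subst (ℚ._≤ 2ℚ) (p-q≡-[q-p] (cap η v) (cap η u)) (oneSided v u u≤2))
  where
  oneSided : ∀ u v → ℚ.∣ v ∣ ℚ.≤ 2ℚ → cap η u ℚ.- cap η v ℚ.≤ 2ℚ
  oneSided u v v≤2 = ≤-by (0≤p*q 0≤½ (0≤p+q (∣u∣≤2⇒0≤4-u*u v≤2) (0≤p*p u)))
    (solve 3 (λ η u v →
        con 2ℚ :- (con 1ℚ :+ η :- con ½ :* (u :* u) :- (con 1ℚ :+ η :- con ½ :* (v :* v)))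
        := con ½ :* ((con 2ℚ :- v) :* (con 2ℚ :- :- v) :+ u :* u))
      refl η u v)

-- u² + v² ≥ (u - v)²/2 ≥ h²/2 = 4 height h.
cap-opposite : ∀ {h} u v → 0ℚ ℚ.≤ h → h ℚ.≤ u ℚ.- v → ℚ.∣ u ∣ ℚ.≤ 2ℚ → ℚ.∣ v ∣ ℚ.≤ 2ℚ →
  ℚ.∣ cap (height h) u ℚ.+ cap (height h) v ∣ ℚ.≤ 2ℚ
cap-opposite {h} u v 0≤h h≤u-v u≤2 v≤2 = ∣p∣≤
  (≤-by (0≤p*q 0≤½ (0≤p*q 0≤½ (0≤p+q (0≤p*p (u ℚ.+ v))
      (0≤p*q (p≤q⇒0≤q-p h≤u-v) (0≤p+q (ℚ.≤-trans 0≤h h≤u-v) 0≤h)))))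
    (solve 3 (λ h u v →
        con 2ℚ :- (con 1ℚ :+ con ⅛ :* (h :* h) :- con ½ :* (u :* u)
                   :+ (con 1ℚ :+ con ⅛ :* (h :* h) :- con ½ :* (v :* v)))
        := con ½ :* (con ½ :* ((u :+ v) :* (u :+ v) :+ (u :- v :- h) :* (u :- v :+ h))))
      refl h u v))
  (≤-by (0≤p+q (0≤p*q 0≤½ (0≤p+q (∣u∣≤2⇒0≤4-u*u u≤2) (∣u∣≤2⇒0≤4-u*u v≤2)))
      (0≤p*q 0≤⅛ (0≤p+q (0≤p*p h) (0≤p*p h))))
    (solve 3 (λ h u v →
        con 2ℚ :- :- (con 1ℚ :+ con ⅛ :* (h :* h) :- con ½ :* (u :* u)
                      :+ (con 1ℚ :+ con ⅛ :* (h :* h) :- con ½ :* (v :* v)))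
        := con ½ :* ((con 2ℚ :- u) :* (con 2ℚ :- :- u) :+ (con 2ℚ :- v) :* (con 2ℚ :- :- v))
           :+ con ⅛ :* (h :* h :+ h :* h))
      refl h u v))

-- The bound on `p + q` is requested under `s ≢ t` because two caps at the same node add up to 2 +
-- 2η there; distinct signs force distinct nodes.
∣±p±q∣≤ : ∀ {s t p q b} → s ≡ 1ℚ ⊎ s ≡ ℚ.- 1ℚ → t ≡ 1ℚ ⊎ t ≡ ℚ.- 1ℚ →
  ℚ.∣ p ℚ.- q ∣ ℚ.≤ b → (s ≢ t → ℚ.∣ p ℚ.+ q ∣ ℚ.≤ b) → ℚ.∣ s ℚ.* p ℚ.- t ℚ.* q ∣ ℚ.≤ b
∣±p±q∣≤ {p = p} {q} {b} (inj₁ refl) (inj₁ refl) same opposite =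
  subst (λ r → ℚ.∣ r ∣ ℚ.≤ b)
    (solve 2 (λ p q → p :- q := con 1ℚ :* p :- con 1ℚ :* q) refl p q) same
∣±p±q∣≤ {p = p} {q} {b} (inj₁ refl) (inj₂ refl) same opposite =
  subst (λ r → ℚ.∣ r ∣ ℚ.≤ b)
    (solve 2 (λ p q → p :+ q := con 1ℚ :* p :- (:- con 1ℚ) :* q) refl p q) (opposite λ ())
∣±p±q∣≤ {p = p} {q} {b} (inj₂ refl) (inj₁ refl) same opposite =
  subst (ℚ._≤ b) (trans (sym (ℚ.∣-p∣≡∣p∣ (p ℚ.+ q)))
    (cong ℚ.∣_∣ (solve 2 (λ p q → :- (p :+ q) := (:- con 1ℚ) :* p :- con 1ℚ :* q) refl p q)))
    (opposite λ ())
∣±p±q∣≤ {p = p} {q} {b} (inj₂ refl) (inj₂ refl) same opposite =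
  subst (ℚ._≤ b) (trans (∣p-q∣≡∣q-p∣ p q)
    (cong ℚ.∣_∣ (solve 2 (λ p q → q :- p := (:- con 1ℚ) :* p :- (:- con 1ℚ) :* q) refl p q)))
    same

node-gap : ∀ {h j k} r → 0ℚ ℚ.≤ h → j ℕ.< k → h ℚ.≤ (r ℚ.- node h j) ℚ.- (r ℚ.- node h k)
node-gap {h} {j} {k} r 0≤h j<k = ≤-by (p≤q⇒0≤q-p (node-mono-≤ 0≤h j<k))
  (solve 4 (λ r x y h → r :- x :- (r :- y) :- h := y :- (x :+ h)) refl r (node h j) (node h k) h)

caps-opposite : ∀ {h j k} r → 0ℚ ℚ.≤ h → j ≢ k →
  ℚ.∣ r ℚ.- node h j ∣ ℚ.≤ 2ℚ → ℚ.∣ r ℚ.- node h k ∣ ℚ.≤ 2ℚ →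
  ℚ.∣ cap (height h) (r ℚ.- node h j) ℚ.+ cap (height h) (r ℚ.- node h k) ∣ ℚ.≤ 2ℚ
caps-opposite {h} {j} {k} r 0≤h j≢k u≤2 v≤2 with ℕ.<-cmp j k
... | tri< j<k _ _ = cap-opposite (r ℚ.- node h j) (r ℚ.- node h k) 0≤h (node-gap r 0≤h j<k) u≤2 v≤2
... | tri≈ _ j≡k _ = contradiction j≡k j≢k
... | tri> _ _ k<j = subst (λ t → ℚ.∣ t ∣ ℚ.≤ 2ℚ)
  (ℚ.+-comm (cap (height h) (r ℚ.- node h k)) (cap (height h) (r ℚ.- node h j)))
  (cap-opposite (r ℚ.- node h k) (r ℚ.- node h j) 0≤h (node-gap r 0≤h k<j) v≤2 u≤2)

-- The family for a given degree and its constants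

module Family (d : ℕ) .{{_ : NonZero d}} where

  h ε : ℚ
  h = 1/n (suc d)
  -- Twice this still fits below `height h`: one ε is the claimed excess, the other pays for
  -- approximating the polynomial.
  ε = 1/n 64 ℚ.* 1/n (d ^ 3) {{m^n≢0 d 3}}

  0≤h : 0ℚ ℚ.≤ h
  0≤h = 0≤1/n (suc d)

  0<ε : 0ℚ ℚ.< ε
  0<ε = ℚ.positive⁻¹ ε {{ℚ.pos*pos⇒pos (1/n 64) δ {{ℚ.positive (0<1/n (d ^ 3) {{m^n≢0 d 3}})}}}}
    where
    δ : ℚ
    δ = 1/n (d ^ 3) {{m^n≢0 d 3}}

  -- From d ≥ 1 come both d + 1 ≤ 2d and d² ≤ d³. Here the natural order 1/d² of `height h` is
  -- weakened to 1/d³.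
  [1+d]²≤4d³ : suc d ℕ.* suc d ℕ.≤ 4 ℕ.* d ^ 3
  [1+d]²≤4d³ = begin
    suc d ℕ.* suc d            ≤⟨ ℕ.*-mono-≤ 1+d≤d+d 1+d≤d+d ⟩
    (d ℕ.+ d) ℕ.* (d ℕ.+ d)    ≡⟨ ℕ-Solver.solve 1
                                    (λ d → (d ⊕ d) ⊗ (d ⊕ d) ⊜ κ 4 ⊗ (d ⊗ (d ⊗ κ 1))) refl d ⟩
    4 ℕ.* d ^ 2                ≤⟨ ℕ.*-monoʳ-≤ 4 (ℕ.^-monoʳ-≤ d (s≤s (s≤s (z≤n {1})))) ⟩
    4 ℕ.* d ^ 3                ∎
    where
    open ℕ.≤-Reasoning
    open ℕ-Solver using () renaming (con to κ; _:+_ to _⊕_; _:*_ to _⊗_; _:=_ to _⊜_)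
    1+d≤d+d : suc d ℕ.≤ d ℕ.+ d
    1+d≤d+d = ℕ.+-monoˡ-≤ d (ℕ.>-nonZero⁻¹ d)

  -- With δ = 1/d³ the gap between the two sides is (4h² - δ)/32.
  ε+ε≤height : ε ℚ.+ ε ℚ.≤ height h
  ε+ε≤height = ≤-by (0≤p*q (0≤1/n 32) (p≤q⇒0≤q-p δ≤4h²))
    (solve 2 (λ δ h² → con ⅛ :* h² :- (con (1/n 64) :* δ :+ con (1/n 64) :* δ)
        := con (1/n 32) :* (con (ι 4) :* h² :- δ)) refl δ (h ℚ.* h))
    where
    open ℚ.≤-Reasoning
    instance d³≢0 = m^n≢0 d 3
    δ e c : ℚ
    δ = 1/n (d ^ 3)
    e = ι (suc d)
    c = ι (d ^ 3)
    δ≤4h² : δ ℚ.≤ ι 4 ℚ.* (h ℚ.* h)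
    -- Insert ((d+1)h)² = 1, bound (d+1)² by 4d³, then cancel d³δ = 1.
    δ≤4h² = begin
      δ
        ≡⟨ solve 1 (λ δ → δ := δ :* (con 1ℚ :* con 1ℚ)) refl δ ⟩
      δ ℚ.* (1ℚ ℚ.* 1ℚ)
        ≡⟨ cong (λ t → δ ℚ.* (t ℚ.* t)) (sym (ι-inverse (suc d))) ⟩
      δ ℚ.* ((e ℚ.* h) ℚ.* (e ℚ.* h))
        ≡⟨ solve 3 (λ δ e h → δ :* ((e :* h) :* (e :* h)) := (δ :* (h :* h)) :* (e :* e)) refl δ e h ⟩
      (δ ℚ.* (h ℚ.* h)) ℚ.* (e ℚ.* e)
        ≤⟨ ℚ.*-monoˡ-≤-nonNeg (δ ℚ.* (h ℚ.* h))
             {{ℚ.nonNegative (0≤p*q (0≤1/n (d ^ 3)) (0≤p*p h))}}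
             (subst₂ ℚ._≤_ (sym (ι-* (suc d) (suc d))) (sym (ι-* 4 (d ^ 3))) (ι-mono-≤ [1+d]²≤4d³)) ⟩
      (δ ℚ.* (h ℚ.* h)) ℚ.* (ι 4 ℚ.* c)
        ≡⟨ solve 3 (λ δ h² c → (δ :* h²) :* (con (ι 4) :* c) := (c :* δ) :* (con (ι 4) :* h²))
             refl δ (h ℚ.* h) c ⟩
      (c ℚ.* δ) ℚ.* (ι 4 ℚ.* (h ℚ.* h))
        ≡⟨ cong (ℚ._* (ι 4 ℚ.* (h ℚ.* h))) (ι-inverse (d ^ 3)) ⟩
      1ℚ ℚ.* (ι 4 ℚ.* (h ℚ.* h))
        ≡⟨ ℚ.*-identityˡ (ι 4 ℚ.* (h ℚ.* h)) ⟩
      ι 4 ℚ.* (h ℚ.* h) ∎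

  0≤node : ∀ j → 0ℚ ℚ.≤ node h j
  0≤node j = node-mono-≤ 0≤h (z≤n {j})

  node≤1 : ∀ {j} → j ℕ.≤ suc d → node h j ℚ.≤ 1ℚ
  node≤1 {j} j≤ = subst (node h j ℚ.≤_) (node-1/n (suc d)) (node-mono-≤ 0≤h j≤)

  ∣node∣≤1 : ∀ {j} → j ℕ.≤ suc d → ℚ.∣ node h j ∣ ℚ.≤ 1ℚ
  ∣node∣≤1 {j} j≤ = subst (ℚ._≤ 1ℚ) (sym (ℚ.0≤p⇒∣p∣≡p (0≤node j))) (node≤1 j≤)

  ∣r-node∣≤2 : ∀ {r j} → ℚ.∣ r ∣ ℚ.≤ 1ℚ → j ℕ.≤ suc d → ℚ.∣ r ℚ.- node h j ∣ ℚ.≤ 2ℚ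
  ∣r-node∣≤2 {r} {j} r≤1 j≤ =
    ℚ.≤-trans (ℚ.∣p-q∣≤∣p∣+∣q∣ r (node h j)) (ℚ.+-mono-≤ r≤1 (∣node∣≤1 j≤))

  family : List (Poly≤ 2)
  -- The indices run from 0 to d + 1, since a (d+1)-st difference involves d + 2 consecutive values.
  family = applyUpTo (parabola h) (suc (suc d))

  -- `f` and `g` stay variables, and the equations are applied only to terms of sequences, so that
  -- no real arithmetic is unfolded.
  parabolas-diameter : ∀ f g {j k} → j ℕ.≤ suc d → k ℕ.≤ suc d →
    f ≡ parabola h j → g ≡ parabola h k → ‖ (λ x → ⟦ f ⟧ x - ⟦ g ⟧ x) ‖∞≤ 2ℝ
  parabolas-diameter f g {j} {k} j≤ k≤ f≡ g≡ = difference-norm≤ f g 2ℝ λ n r r≤1 →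
    subst₂ (λ p q → ℚ.∣ p ℚ.- q ∣ ℚ.≤ 2ℚ)
      (sym (trans (cong (λ p → (⟦ p ⟧ at n) r) f≡) (parabola-at h j n r)))
      (sym (trans (cong (λ p → (⟦ p ⟧ at n) r) g≡) (parabola-at h k n r)))
      (∣±p±q∣≤ (sign≡±1 j) (sign≡±1 k)
        (cap-same (height h) (r ℚ.- node h j) (r ℚ.- node h k)
          (∣r-node∣≤2 r≤1 j≤) (∣r-node∣≤2 r≤1 k≤))
        (λ sj≢sk → caps-opposite {h} {j} {k} r 0≤h (λ j≡k → sj≢sk (cong sign j≡k))
          (∣r-node∣≤2 r≤1 j≤) (∣r-node∣≤2 r≤1 k≤)))

  family-diameter : ∀ f g → f ∈ family → g ∈ family → ‖ (λ x → ⟦ f ⟧ x - ⟦ g ⟧ x) ‖∞≤ 2ℝ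
  family-diameter f g f∈ g∈ =
    let j , j<2+d , f≡ = ∈-applyUpTo⁻ (parabola h) f∈
        k , k<2+d , g≡ = ∈-applyUpTo⁻ (parabola h) g∈
    in parabolas-diameter f g {j} {k} (ℕ.s≤s⁻¹ j<2+d) (ℕ.s≤s⁻¹ k<2+d) f≡ g≡

  sign*parabola : ∀ j n → sign j ℚ.* (⟦ parabola h j ⟧ at n) (node h j) ≡ 1ℚ ℚ.+ height h
  sign*parabola j n = trans (cong (sign j ℚ.*_) (parabola-at h j n (node h j)))
    (trans (solve 3 (λ s η x → s :* (s :* (con 1ℚ :+ η :- con ½ :* ((x :- x) :* (x :- x))))
                       := (s :* s) :* (con 1ℚ :+ η)) refl (sign j) (height h) (node h j))
      (trans (cong (ℚ._* (1ℚ ℚ.+ height h)) (sign*sign j)) (ℚ.*-identityˡ _)))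

  -- Here `A` is the fixed approximation of the polynomial at the node, `a` a later one and `P` the
  -- value of the parabola. Then -s(a - P) = sP - s(a - A) - sA ≥ (1 + η) - ε - 0 ≥ 1 + ε.
  separation : ∀ {s a A P η} → s ℚ.* A ℚ.≤ 0ℚ → s ℚ.* (a ℚ.- A) ℚ.≤ ε → s ℚ.* P ≡ 1ℚ ℚ.+ η →
    ε ℚ.+ ε ℚ.≤ η → 1ℚ ℚ.+ ε ℚ.≤ ℚ.- (s ℚ.* (a ℚ.- P))
  separation {s} {a} {A} {P} {η} sA≤0 s[a-A]≤ε sP≡1+η 2ε≤η = ≤-by
    (0≤p+q (0≤p+q (p≤q⇒0≤q-p sA≤0) (p≤q⇒0≤q-p s[a-A]≤ε))
      (0≤p+q (p≤q⇒0≤q-p 2ε≤η) (p≤q⇒0≤q-p (ℚ.≤-reflexive (sym sP≡1+η)))))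
    (solve 6 (λ s a A P η ε → :- (s :* (a :- P)) :- (con 1ℚ :+ ε)
        := con 0ℚ :- s :* A :+ (ε :- s :* (a :- A)) :+ (η :- (ε :+ ε) :+ (s :* P :- (con 1ℚ :+ η))))
      refl s a A P η ε)

  1+cd⁻³ : ℝ
  1+cd⁻³ = 1ℝ + _÷_ (fromℚ (1/n 64)) (d ^ 3) {{m^n≢0 d 3}}

  far-from-parabola : ∀ (q : Poly≤ d) f {j N} → j ℕ.≤ suc d → f ≡ parabola h j →
    sign j ℚ.* (⟦ q ⟧ at N) (node h j) ℚ.≤ 0ℚ →
    (∀ n → N ℕ.≤ n → ℚ.∣ (⟦ q ⟧ at n) (node h j) ℚ.- (⟦ q ⟧ at N) (node h j) ∣ ℚ.≤ ε) →
    ‖ (λ x → ⟦ q ⟧ x - ⟦ f ⟧ x) ‖∞≥ 1+cd⁻³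
  far-from-parabola q f {j} {N} j≤ f≡ sq≤0 close =
    difference-norm≥ q f 1+cd⁻³ {N} {node h j} (∣node∣≤1 j≤) far
    where
    Q F : ℕ → ℚ
    Q n = (⟦ q ⟧ at n) (node h j)
    F n = (⟦ f ⟧ at n) (node h j)
    sign*F : ∀ n → sign j ℚ.* F n ≡ 1ℚ ℚ.+ height h
    sign*F n = trans (cong (λ p → sign j ℚ.* (⟦ p ⟧ at n) (node h j)) f≡) (sign*parabola j n)
    stable : ∀ n → N ℕ.≤ n → sign j ℚ.* (Q n ℚ.- Q N) ℚ.≤ ε
    stable n N≤n = ℚ.≤-trans (sign*≤∣∣ j (Q n ℚ.- Q N)) (close n N≤n)
    far : ∀ n → N ℕ.≤ n → 1ℚ ℚ.+ ε ℚ.≤ ℚ.∣ Q n ℚ.- F n ∣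
    far n N≤n = ℚ.≤-trans
      (separation {sign j} {Q n} {Q N} {F n} {height h} sq≤0 (stable n N≤n) (sign*F n) ε+ε≤height)
      (-sign*≤∣∣ j (Q n ℚ.- F n))

  far-from-family : (q : Poly≤ d) → Σ[ f ∈ Poly≤ 2 ]
    (f ∈ family × ‖ (λ x → ⟦ q ⟧ x - ⟦ f ⟧ x) ‖∞≥ 1+cd⁻³)
  -- The node is read off from the approximation with index `N`, so `N` has to be fixed before the
  -- node is known; uniformity over [-1 , 1] allows this.
  far-from-family q = witness (uniformlyCauchy {⟦ q ⟧} (horner-regular q) ε 0<ε)
    where
    witness : ∃[ N ] (∀ m n r → N ℕ.≤ m → N ℕ.≤ n → ℚ.∣ r ∣ ℚ.≤ 1ℚ →
        ℚ.∣ (⟦ q ⟧ at m) r ℚ.- (⟦ q ⟧ at n) r ∣ ℚ.≤ ε) →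
      Σ[ f ∈ Poly≤ 2 ] (f ∈ family × ‖ (λ x → ⟦ q ⟧ x - ⟦ f ⟧ x) ‖∞≥ 1+cd⁻³)
    witness (N , close) = choose
      (¬alternating (suc d) {λ j → (⟦ q ⟧ at N) (node h j)} (horner-annihilated q h N))
      where
      choose : ∃[ j ] (j ℕ.≤ suc d × sign j ℚ.* (⟦ q ⟧ at N) (node h j) ℚ.≤ 0ℚ) →
        Σ[ f ∈ Poly≤ 2 ] (f ∈ family × ‖ (λ x → ⟦ q ⟧ x - ⟦ f ⟧ x) ‖∞≥ 1+cd⁻³)
      choose (j , j≤ , sq≤0) = parabola h j , ∈-applyUpTo⁺ (parabola h) (s≤s j≤)
        , far-from-parabola q (parabola h j) {j} {N} j≤ refl sq≤0
            λ n N≤n → close n N (node h j) N≤n ℕ.≤-refl (∣node∣≤1 j≤)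

  length-family : fromℕ (length family) ≤ fromℕ 3 * fromℕ d
  length-family ε 0<ε = 0 , λ _ _ → p≤q+ε
    (subst₂ ℚ._≤_ (cong ι (sym (length-applyUpTo (parabola h) (suc (suc d))))) (sym (ι-* 3 d))
      (ι-mono-≤ 2+d≤3d)) 0<ε
    where
    open ℕ-Solver using () renaming (con to κ; _:+_ to _⊕_; _:*_ to _⊗_; _:=_ to _⊜_)
    2+d≤3d : suc (suc d) ℕ.≤ 3 ℕ.* d
    -- The d + 2 parabolas number at most 3d because 2 ≤ d + d, whence K = 3.
    2+d≤3d = ℕ.≤-trans (ℕ.+-monoˡ-≤ d (ℕ.+-mono-≤ (ℕ.>-nonZero⁻¹ d) (ℕ.>-nonZero⁻¹ d)))
      (ℕ.≤-reflexive (ℕ-Solver.solve 1 (λ d → d ⊕ d ⊕ d ⊜ κ 3 ⊗ d) refl d))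

lemma5p7 : Σ[ K ∈ ℝ ] Σ[ c ∈ ℝ ] (0ℝ < K × 0ℝ < c ×
    ((d : ℕ) → .{{_ : NonZero d}} →
    Σ[ S ∈ List (Poly≤ 2) ]
    (fromℕ (length S) ≤ K * fromℕ d
    × (∀ f g → f ∈ S → g ∈ S → ‖ (λ x → ⟦ f ⟧ x - ⟦ g ⟧ x) ‖∞≤ 2ℝ)
    × ((q : Poly≤ d) →
    Σ[ f ∈ Poly≤ 2 ]
    (f ∈ S
    × ‖ (λ x → ⟦ q ⟧ x - ⟦ f ⟧ x) ‖∞≥ (1ℝ + _÷_ c (d ^ 3) {{m^n≢0 d 3}}))))))
lemma5p7 = fromℕ 3 , fromℚ (1/n 64)
  , (1ℚ , ℚ.positive⁻¹ 1ℚ , 0 , λ _ _ → ℚ.≤ᵇ⇒≤ _)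
  , (1/n 64 , 0<1/n 64 , 0 , λ _ _ → ℚ.≤ᵇ⇒≤ _)
  , λ d → family d , length-family d , family-diameter d , far-from-family d
  where open Family
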